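{- Let $x$ be a positive integer and for $k\geq 1$ let $$F_k(x):=\left[x,\frac{1}{x},x^2,\frac{1}{x^2},x^3,\frac{1}{x^3},\dots,x^k,\frac{1}{x^k}\right]$$ and $$F_k^{*}(x):=\left[x,\frac{1}{x},x^2,\frac{1}{x^2},x^3,\frac{1}{x^3},\dots,x^{k-1},\frac{1}{x^{k-1}},x^k\right].$$ Then, as $k\to\infty$, both $F_k(x)$ and $F_k^{*}(x)$ converge to the positive root (in $z$) of $P(x,z)=z^2-(2x-1)z-x$.
   Context: For positive real numbers $b_0,b_1,\dots,b_n$, the notation $[b_0,b_1,\dots,b_n]$ denotes the finite continued fraction $b_0+\cfrac{1}{b_1+\cfrac{1}{b_2+\cdots+\cfrac{1}{b_n}}}$; the partial quotients need not be integers. $F_k(x)$ has $2k$ partial quotients, and $F_k^*(x)$ has $2k-1$ partial quotients (it is $F_k(x)$ with the last partial quotient $1/x^k$ removed; in particular $F_1^*(x)=[x]=x$). They are the odd-indexed and even-indexed convergents, respectively, of the infinite continued fraction $[x,\frac1x,x^2,\frac1{x^2},x^3,\frac{1}{x^3},\dots]$, with convergents indexed from $0$. -}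

module Defs where

open import Data.Integer using (+_)
open import Data.List as List using (List; []; _∷_; applyUpTo; concatMap)
open import Data.List.NonEmpty as List⁺ using (List⁺; _∷_; _++⁺_)
open import Data.Nat as ℕ using (ℕ; suc; pred)
import Data.Nat.Properties as ℕ
open import Data.Product using (∃; ∃-syntax; _×_; _,_)
open import Data.Rational as ℚ using (ℚ; 0ℚ; 1ℚ; ½; Positive)
import Data.Rational.Properties as ℚ
open import Data.Rational.Solver using (module +-*-Solver)
open import Data.Sum using (inj₁; inj₂)
open import Relation.Binary.PropositionalEquality
  using (_≡_; refl; sym; trans; cong; cong₂; subst)

-- Finite continued fractions with positive rational partial quotients.

record ℚ⁺ : Set where
  constructor mkℚ⁺
  field
    value          : ℚ
    .{{positive}}  : Positive value

open ℚ⁺ public using (value)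

_+⁺_ : ℚ⁺ → ℚ⁺ → ℚ⁺
mkℚ⁺ p +⁺ mkℚ⁺ q = mkℚ⁺ (p ℚ.+ q) {{ℚ.pos+pos⇒pos p q}}

infix 8 1/⁺_

1/⁺_ : ℚ⁺ → ℚ⁺
1/⁺ mkℚ⁺ p = mkℚ⁺ ((ℚ.1/ p) {{ℚ.pos⇒nonZero p}}) {{ℚ.1/pos⇒pos p}}

-- ⟦ b₀ ∷ b₁ ∷ … ∷ bₙ ∷ [] ⟧ is [b₀, b₁, …, bₙ].
⟦_⟧ : List⁺ ℚ⁺ → ℚ⁺
⟦_⟧ = List⁺.foldr₁ (λ b t → b +⁺ (1/⁺ t))

_^⁺_ : (x : ℕ) .{{_ : ℕ.NonZero x}} → ℕ → ℚ⁺
x ^⁺ k = mkℚ⁺ (+ (x ℕ.^ k) ℚ./ 1)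
  {{ℚ.normalize-pos (x ℕ.^ k) 1 {{_}} {{ℕ.m^n≢0 x k}}}}

-- x , 1/x , x² , 1/x² , … , xᵏ , 1/xᵏ
quotients : (x : ℕ) .{{_ : ℕ.NonZero x}} → ℕ → List ℚ⁺
quotients x k =
  concatMap (λ i → x ^⁺ i ∷ 1/⁺ (x ^⁺ i) ∷ []) (applyUpTo suc k)

F : (x : ℕ) .{{_ : ℕ.NonZero x}} (k : ℕ) .{{_ : ℕ.NonZero k}} → ℚ
F x k = value ⟦ quotients x (pred k) ++⁺ (x ^⁺ k ∷ 1/⁺ (x ^⁺ k) ∷ []) ⟧

F* : (x : ℕ) .{{_ : ℕ.NonZero x}} (k : ℕ) .{{_ : ℕ.NonZero k}} → ℚ
F* x k = value ⟦ quotients x (pred k) ++⁺ (x ^⁺ k ∷ []) ⟧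

-- Real numbers as Cauchy sequences of rationals; their equality is _≃_.

IsCauchy : (ℕ → ℚ) → Set
IsCauchy a = ∀ ε → 0ℚ ℚ.< ε →
  ∃[ N ] ∀ m n → N ℕ.≤ m → N ℕ.≤ n → ℚ.∣ a m ℚ.- a n ∣ ℚ.< ε

record ℝ : Set where
  constructor mkℝ
  field
    seq    : ℕ → ℚ
    cauchy : IsCauchy seq

open ℝ public

infix 4 _≃_ _<_

_≃_ : ℝ → ℝ → Set
x ≃ y = ∀ ε → 0ℚ ℚ.< ε →
  ∃[ N ] ∀ n → N ℕ.≤ n → ℚ.∣ seq x n ℚ.- seq y n ∣ ℚ.< ε

_<_ : ℝ → ℝ → Set
x < y = ∃[ ε ] 0ℚ ℚ.< ε ×
  ∃[ N ] ∀ n → N ℕ.≤ n → seq x n ℚ.+ ε ℚ.< seq y n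

fromℚ : ℚ → ℝ
fromℚ q = mkℝ (λ _ → q) λ ε 0<ε →
  0 , λ _ _ _ _ → subst (ℚ._< ε) (cong ℚ.∣_∣ (sym (ℚ.+-inverseʳ q))) 0<ε

fromℕ : ℕ → ℝ
fromℕ n = fromℚ (+ n ℚ./ 1)

module CauchyProperties where
  open +-*-Solver using (solve; _:=_; _:+_; _:-_; _:*_; :-_)

  0<½* : ∀ ε → 0ℚ ℚ.< ε → 0ℚ ℚ.< ½ ℚ.* ε
  0<½* ε 0<ε =
    subst (ℚ._< ½ ℚ.* ε) (ℚ.*-zeroʳ ½) (ℚ.*-monoʳ-<-pos ½ 0<ε)

  ½*+½* : ∀ ε → ½ ℚ.* ε ℚ.+ ½ ℚ.* ε ≡ ε
  ½*+½* ε = trans (sym (ℚ.*-distribʳ-+ ε ½ ½)) (ℚ.*-identityˡ ε)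

  ∣-∣-swap : ∀ p q → ℚ.∣ p ℚ.- q ∣ ≡ ℚ.∣ q ℚ.- p ∣
  ∣-∣-swap p q = trans (sym (ℚ.∣-p∣≡∣p∣ (p ℚ.- q)))
    (cong ℚ.∣_∣ (solve 2 (λ p q → :- (p :- q) := q :- p) refl p q))

  ∣p∣≤∣p-q∣+∣q∣ : ∀ p q → ℚ.∣ p ∣ ℚ.≤ ℚ.∣ p ℚ.- q ∣ ℚ.+ ℚ.∣ q ∣
  ∣p∣≤∣p-q∣+∣q∣ p q = subst (λ r → ℚ.∣ r ∣ ℚ.≤ ℚ.∣ p ℚ.- q ∣ ℚ.+ ℚ.∣ q ∣)
    (solve 2 (λ p q → (p :- q) :+ q := p) refl p q)
    (ℚ.∣p+q∣≤∣p∣+∣q∣ (p ℚ.- q) q)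

  ∣p∣-∣q∣≤∣p-q∣ : ∀ p q → ℚ.∣ p ∣ ℚ.- ℚ.∣ q ∣ ℚ.≤ ℚ.∣ p ℚ.- q ∣
  ∣p∣-∣q∣≤∣p-q∣ p q =
    subst (ℚ.∣ p ∣ ℚ.- ℚ.∣ q ∣ ℚ.≤_)
      (solve 2 (λ a b → (a :+ b) :- b := a) refl ℚ.∣ p ℚ.- q ∣ ℚ.∣ q ∣)
      (ℚ.+-monoˡ-≤ (ℚ.- ℚ.∣ q ∣) (∣p∣≤∣p-q∣+∣q∣ p q))

  ∣∣p∣-∣q∣∣≤∣p-q∣ : ∀ p q → ℚ.∣ ℚ.∣ p ∣ ℚ.- ℚ.∣ q ∣ ∣ ℚ.≤ ℚ.∣ p ℚ.- q ∣
  ∣∣p∣-∣q∣∣≤∣p-q∣ p q with ℚ.∣p∣≡p∨∣p∣≡-p (ℚ.∣ p ∣ ℚ.- ℚ.∣ q ∣)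
  ... | inj₁ eq = subst (ℚ._≤ ℚ.∣ p ℚ.- q ∣) (sym eq) (∣p∣-∣q∣≤∣p-q∣ p q)
  ... | inj₂ eq = subst (ℚ._≤ ℚ.∣ p ℚ.- q ∣)
    (sym (trans eq
      (solve 2 (λ a b → :- (a :- b) := b :- a) refl ℚ.∣ p ∣ ℚ.∣ q ∣)))
    (subst (ℚ.∣ q ∣ ℚ.- ℚ.∣ p ∣ ℚ.≤_) (∣-∣-swap q p) (∣p∣-∣q∣≤∣p-q∣ q p))

  +-diff : ∀ p q r s →
    (p ℚ.+ q) ℚ.- (r ℚ.+ s) ≡ (p ℚ.- r) ℚ.+ (q ℚ.- s)
  +-diff = solve 4
    (λ p q r s → (p :+ q) :- (r :+ s) := (p :- r) :+ (q :- s)) refl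

  +-cauchy : ∀ {a b} → IsCauchy a → IsCauchy b → IsCauchy (λ n → a n ℚ.+ b n)
  +-cauchy {a} {b} ca cb ε 0<ε
    with N , a-close ← ca (½ ℚ.* ε) (0<½* ε 0<ε)
       | M , b-close ← cb (½ ℚ.* ε) (0<½* ε 0<ε)
    = N ℕ.⊔ M , λ m n K≤m K≤n → begin-strict
      ℚ.∣ (a m ℚ.+ b m) ℚ.- (a n ℚ.+ b n) ∣
        ≡⟨ cong ℚ.∣_∣ (+-diff (a m) (b m) (a n) (b n)) ⟩
      ℚ.∣ (a m ℚ.- a n) ℚ.+ (b m ℚ.- b n) ∣
        ≤⟨ ℚ.∣p+q∣≤∣p∣+∣q∣ (a m ℚ.- a n) (b m ℚ.- b n) ⟩
      ℚ.∣ a m ℚ.- a n ∣ ℚ.+ ℚ.∣ b m ℚ.- b n ∣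
        <⟨ ℚ.+-mono-<
             (a-close m n (ℕ.m⊔n≤o⇒m≤o N M K≤m) (ℕ.m⊔n≤o⇒m≤o N M K≤n))
             (b-close m n (ℕ.m⊔n≤o⇒n≤o N M K≤m) (ℕ.m⊔n≤o⇒n≤o N M K≤n)) ⟩
      ½ ℚ.* ε ℚ.+ ½ ℚ.* ε
        ≡⟨ ½*+½* ε ⟩
      ε ∎
    where open ℚ.≤-Reasoning

  neg-cauchy : ∀ {a} → IsCauchy a → IsCauchy (λ n → ℚ.- a n)
  neg-cauchy {a} ca ε 0<ε with N , close ← ca ε 0<ε =
    N , λ m n N≤m N≤n → subst (ℚ._< ε)
      (trans (∣-∣-swap (a m) (a n))
        (cong ℚ.∣_∣ (solve 2 (λ p q → q :- p := (:- p) :- (:- q))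
          refl (a m) (a n))))
      (close m n N≤m N≤n)

  ∣∣-cauchy : ∀ {a} → IsCauchy a → IsCauchy (λ n → ℚ.∣ a n ∣)
  ∣∣-cauchy {a} ca ε 0<ε with N , close ← ca ε 0<ε =
    N , λ m n N≤m N≤n →
      ℚ.≤-<-trans (∣∣p∣-∣q∣∣≤∣p-q∣ (a m) (a n)) (close m n N≤m N≤n)

  bounded : ∀ {a} → IsCauchy a →
    ∃[ B ] 0ℚ ℚ.< B × ∃[ N ] ∀ n → N ℕ.≤ n → ℚ.∣ a n ∣ ℚ.≤ B
  bounded {a} ca with N , close ← ca 1ℚ (ℚ.positive⁻¹ 1ℚ) =
    1ℚ ℚ.+ ℚ.∣ a N ∣ ,
    ℚ.+-mono-<-≤ (ℚ.positive⁻¹ 1ℚ) (ℚ.0≤∣p∣ (a N)) ,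
    N , λ n N≤n → ℚ.≤-trans (∣p∣≤∣p-q∣+∣q∣ (a n) (a N))
      (ℚ.+-monoˡ-≤ ℚ.∣ a N ∣ (ℚ.<⇒≤ (close n N N≤n ℕ.≤-refl)))

  split : ∀ B → 0ℚ ℚ.< B → ∀ ε → 0ℚ ℚ.< ε → ∃[ δ ] 0ℚ ℚ.< δ × B ℚ.* δ ≡ ε
  split B 0<B ε 0<ε = 1/B ℚ.* ε ,
    ℚ.positive⁻¹ (1/B ℚ.* ε) {{ℚ.pos*pos⇒pos 1/B {{ℚ.1/pos⇒pos B}} ε}} ,
    trans (sym (ℚ.*-assoc B 1/B ε))
      (trans (cong (ℚ._* ε) (ℚ.*-inverseʳ B)) (ℚ.*-identityˡ ε))
    where
    instance
      B-pos : Positive B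
      B-pos = ℚ.positive 0<B
      ε-pos : Positive ε
      ε-pos = ℚ.positive 0<ε
      B≢0 : ℚ.NonZero B
      B≢0 = ℚ.pos⇒nonZero B
    1/B : ℚ
    1/B = ℚ.1/ B

  ∣p*q∣< : ∀ p q {B δ} → 0ℚ ℚ.< B → ℚ.∣ p ∣ ℚ.≤ B → ℚ.∣ q ∣ ℚ.< δ →
    ℚ.∣ p ℚ.* q ∣ ℚ.< B ℚ.* δ
  ∣p*q∣< p q {B} {δ} 0<B p≤B q<δ = begin-strict
    ℚ.∣ p ℚ.* q ∣
      ≡⟨ ℚ.∣p*q∣≡∣p∣*∣q∣ p q ⟩
    ℚ.∣ p ∣ ℚ.* ℚ.∣ q ∣
      ≤⟨ ℚ.*-monoʳ-≤-nonNeg ℚ.∣ q ∣ {{ℚ.∣-∣-nonNeg q}} p≤B ⟩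
    B ℚ.* ℚ.∣ q ∣
      <⟨ ℚ.*-monoʳ-<-pos B {{ℚ.positive 0<B}} q<δ ⟩
    B ℚ.* δ ∎
    where open ℚ.≤-Reasoning

  *-diff : ∀ p q r s →
    p ℚ.* q ℚ.- r ℚ.* s ≡ p ℚ.* (q ℚ.- s) ℚ.+ s ℚ.* (p ℚ.- r)
  *-diff = solve 4
    (λ p q r s → p :* q :- r :* s := p :* (q :- s) :+ s :* (p :- r)) refl

  *-close : ∀ p q r s {A B δ η} → 0ℚ ℚ.< A → 0ℚ ℚ.< B →
    ℚ.∣ p ∣ ℚ.≤ A → ℚ.∣ s ∣ ℚ.≤ B →
    ℚ.∣ q ℚ.- s ∣ ℚ.< δ → ℚ.∣ p ℚ.- r ∣ ℚ.< η →
    ℚ.∣ p ℚ.* q ℚ.- r ℚ.* s ∣ ℚ.< A ℚ.* δ ℚ.+ B ℚ.* η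
  *-close p q r s {A} {B} {δ} {η} 0<A 0<B p≤A s≤B q-s<δ p-r<η = begin-strict
    ℚ.∣ p ℚ.* q ℚ.- r ℚ.* s ∣
      ≡⟨ cong ℚ.∣_∣ (*-diff p q r s) ⟩
    ℚ.∣ p ℚ.* (q ℚ.- s) ℚ.+ s ℚ.* (p ℚ.- r) ∣
      ≤⟨ ℚ.∣p+q∣≤∣p∣+∣q∣ (p ℚ.* (q ℚ.- s)) (s ℚ.* (p ℚ.- r)) ⟩
    ℚ.∣ p ℚ.* (q ℚ.- s) ∣ ℚ.+ ℚ.∣ s ℚ.* (p ℚ.- r) ∣
      <⟨ ℚ.+-mono-< (∣p*q∣< p (q ℚ.- s) 0<A p≤A q-s<δ)
                    (∣p*q∣< s (p ℚ.- r) 0<B s≤B p-r<η) ⟩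
    A ℚ.* δ ℚ.+ B ℚ.* η ∎
    where open ℚ.≤-Reasoning

  *-cauchy : ∀ {a b} → IsCauchy a → IsCauchy b → IsCauchy (λ n → a n ℚ.* b n)
  *-cauchy {a} {b} ca cb ε 0<ε =
    let A , 0<A , N₁ , a≤A = bounded ca
        B , 0<B , N₂ , b≤B = bounded cb
        δ , 0<δ , Aδ = split A 0<A (½ ℚ.* ε) (0<½* ε 0<ε)
        η , 0<η , Bη = split B 0<B (½ ℚ.* ε) (0<½* ε 0<ε)
        N₃ , a-close = ca η 0<η
        N₄ , b-close = cb δ 0<δ
    in (N₁ ℕ.⊔ N₂) ℕ.⊔ (N₃ ℕ.⊔ N₄) , λ m n K≤m K≤n →
      let m₁₂ = ℕ.m⊔n≤o⇒m≤o (N₁ ℕ.⊔ N₂) (N₃ ℕ.⊔ N₄) K≤m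
          n₁₂ = ℕ.m⊔n≤o⇒m≤o (N₁ ℕ.⊔ N₂) (N₃ ℕ.⊔ N₄) K≤n
          m₃₄ = ℕ.m⊔n≤o⇒n≤o (N₁ ℕ.⊔ N₂) (N₃ ℕ.⊔ N₄) K≤m
          n₃₄ = ℕ.m⊔n≤o⇒n≤o (N₁ ℕ.⊔ N₂) (N₃ ℕ.⊔ N₄) K≤n
      in subst (ℚ.∣ a m ℚ.* b m ℚ.- a n ℚ.* b n ∣ ℚ.<_)
           (trans (cong₂ ℚ._+_ Aδ Bη) (½*+½* ε))
           (*-close (a m) (b m) (a n) (b n) 0<A 0<B
             (a≤A m (ℕ.m⊔n≤o⇒m≤o N₁ N₂ m₁₂))
             (b≤B n (ℕ.m⊔n≤o⇒n≤o N₁ N₂ n₁₂))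
             (b-close m n (ℕ.m⊔n≤o⇒n≤o N₃ N₄ m₃₄) (ℕ.m⊔n≤o⇒n≤o N₃ N₄ n₃₄))
             (a-close m n (ℕ.m⊔n≤o⇒m≤o N₃ N₄ m₃₄) (ℕ.m⊔n≤o⇒m≤o N₃ N₄ n₃₄)))

open CauchyProperties

infix  8 -_
infixl 7 _*_
infixl 6 _+_ _-_

_+_ : ℝ → ℝ → ℝ
x + y = mkℝ (λ n → seq x n ℚ.+ seq y n)
  (+-cauchy {seq x} {seq y} (cauchy x) (cauchy y))

-_ : ℝ → ℝ
- x = mkℝ (λ n → ℚ.- seq x n) (neg-cauchy {seq x} (cauchy x))

_-_ : ℝ → ℝ → ℝ
x - y = x + (- y)

_*_ : ℝ → ℝ → ℝ
x * y = mkℝ (λ n → seq x n ℚ.* seq y n)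
  (*-cauchy {seq x} {seq y} (cauchy x) (cauchy y))

∣_∣ : ℝ → ℝ
∣ x ∣ = mkℝ (λ n → ℚ.∣ seq x n ∣) (∣∣-cauchy {seq x} (cauchy x))

-- Sequences s₁ , s₂ , s₃ , … are indexed from 1.

infix 4 _⟶_

_⟶_ : ((k : ℕ) .{{_ : ℕ.NonZero k}} → ℝ) → ℝ → Set
s ⟶ z = ∀ ε → fromℕ 0 < ε →
  ∃[ K ] ∀ k .{{_ : ℕ.NonZero k}} → K ℕ.≤ k → ∣ s k - z ∣ < ε

P : ℝ → ℝ → ℝ
P x z = z * z - (fromℕ 2 * x - fromℕ 1) * z - x

IsPositiveRoot : ℕ → ℝ → Set
IsPositiveRoot x z = fromℕ 0 < z × P (fromℕ x) z ≃ fromℕ 0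

{-# OPTIONS --safe #-}
module Submission where

-- The tail [x², 1/x², x³, 1/x³, …] of the continued fraction is x times the whole, since
-- multiplying a continued fraction by x multiplies and divides its partial quotients by x
-- alternately. Hence F and F* both iterate g(a) = x + 1/(1/x + 1/(xa)) = x(2a + 1)/(a + 1),
-- from 2x and x, and the fixed points of g are the roots of P. As
-- P(g(a)) = x P(a)/(a + 1)², the values of P tend to 0 along both orbits, and a
-- positive b is close to F when P(b) is close to P(F).

open import Defs
open import Data.Nat using (ℕ; NonZero)
open import Data.Product using (_×_; ∃!)

open import Data.Integer as ℤ using (+_)
import Data.Integer.Properties as ℤ
open import Data.List as List using (List; []; _∷_; applyUpTo; concatMap)
open import Data.List.NonEmpty using (_∷_; _++⁺_)
open import Data.List.Properties using (map-applyUpTo)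
open import Data.Nat as ℕ using (zero; suc)
import Data.Nat.Coprimality as ℕ
import Data.Nat.Properties as ℕ
open import Data.Product using (∃-syntax; _,_; proj₁; proj₂)
open import Data.Rational as ℚ using (ℚ; 0ℚ; 1ℚ; ½; Positive)
import Data.Rational.Properties as ℚ
open import Data.Rational.Solver using (module +-*-Solver)
open import Data.Sum using (inj₁; inj₂)
open import Relation.Binary.PropositionalEquality
open +-*-Solver using (solve; _:=_; _:+_; _:-_; _:*_; :-_; con)

-- Natural numbers inside the rationals.

ι : ℕ → ℚ
ι n = + n ℚ./ 1

ι-coprime : ∀ n → ℕ.Coprime n 1
ι-coprime n = ℕ.sym (ℕ.1-coprimeTo n)

-- For a variable `n` the normalisation hidden in `ι n` is stuck on a gcd. Rewriting to an explicit
-- fraction lets sums, products and comparisons unfold to integer ones.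
ι≡mkℚ : ∀ n → ι n ≡ ℚ.mkℚ (+ n) 0 (ι-coprime n)
ι≡mkℚ n = ℚ.normalize-coprime (ι-coprime n)

ι-* : ∀ m n → ι (m ℕ.* n) ≡ ι m ℚ.* ι n
ι-* m n rewrite ι≡mkℚ m | ι≡mkℚ n = cong (ℚ._/ 1) (ℤ.pos-* m n)

ι-+ : ∀ m n → ι (m ℕ.+ n) ≡ ι m ℚ.+ ι n
ι-+ m n rewrite ι≡mkℚ m | ι≡mkℚ n = cong (ℚ._/ 1) (trans (ℤ.pos-+ m n)
  (sym (cong₂ ℤ._+_ (ℤ.*-identityʳ (+ m)) (ℤ.*-identityʳ (+ n)))))

ι-mono-≤ : ∀ {m n} → m ℕ.≤ n → ι m ℚ.≤ ι n
ι-mono-≤ {m} {n} m≤n rewrite ι≡mkℚ m | ι≡mkℚ n =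
  ℚ.*≤* (ℤ.*-monoʳ-≤-nonNeg (+ 1) (ℤ.+≤+ m≤n))

-- The absolute value of the numerator suffices, as the denominator is at least 1.
archimedean : ∀ q → ∃[ n ] q ℚ.≤ ι n
archimedean q@(ℚ.mkℚ u d-1 _) = ℤ.∣ u ∣ , subst (q ℚ.≤_) (sym (ι≡mkℚ ℤ.∣ u ∣))
  (ℚ.*≤* (begin
    u ℤ.* + 1                  ≡⟨ ℤ.*-identityʳ u ⟩
    u                          ≤⟨ i≤∣i∣ u ⟩
    + ℤ.∣ u ∣                  ≤⟨ ℤ.+≤+ (ℕ.m≤m*n ℤ.∣ u ∣ (suc d-1)) ⟩
    + (ℤ.∣ u ∣ ℕ.* suc d-1)    ≡⟨ ℤ.pos-* ℤ.∣ u ∣ (suc d-1) ⟩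
    + ℤ.∣ u ∣ ℤ.* + suc d-1    ∎))
  where
  open ℤ.≤-Reasoning
  i≤∣i∣ : ∀ i → i ℤ.≤ + ℤ.∣ i ∣
  i≤∣i∣ (+ n)      = ℤ.≤-refl
  i≤∣i∣ ℤ.-[1+ n ] = ℤ.-≤+

-- Quotients are described below by equations cleared of denominators, which keeps them within reach
-- of the ring solver; this is how a positive factor is removed again.
*-cancelʳ-pos : ∀ r .{{_ : Positive r}} {p q} → p ℚ.* r ≡ q ℚ.* r → p ≡ q
*-cancelʳ-pos r eq = ℚ.≤-antisym
  (ℚ.*-cancelʳ-≤-pos r (ℚ.≤-reflexive eq))
  (ℚ.*-cancelʳ-≤-pos r (ℚ.≤-reflexive (sym eq)))

-- Continued fractions

0<value : ∀ t → 0ℚ ℚ.< value t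
0<value (mkℚ⁺ p) = ℚ.positive⁻¹ p

1/⁺-inverseˡ : ∀ t → value (1/⁺ t) ℚ.* value t ≡ 1ℚ
1/⁺-inverseˡ (mkℚ⁺ p {{pos}}) = ℚ.*-inverseˡ p {{ℚ.pos⇒nonZero p}}

1/⁺-involutive : ∀ t → value (1/⁺ (1/⁺ t)) ≡ value t
1/⁺-involutive (mkℚ⁺ p) = ℚ.1/-involutive p {{ℚ.pos⇒nonZero p}}

+1/⁺-* : ∀ b t → value (b +⁺ (1/⁺ t)) ℚ.* value t ≡ value b ℚ.* value t ℚ.+ 1ℚ
+1/⁺-* b t = trans (ℚ.*-distribʳ-+ (value t) (value b) (value (1/⁺ t)))
  (cong (value b ℚ.* value t ℚ.+_) (1/⁺-inverseˡ t))

b+1/1/b : ∀ b → value (b +⁺ (1/⁺ (1/⁺ b))) ≡ value b ℚ.+ value b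
b+1/1/b b = cong (value b ℚ.+_) (1/⁺-involutive b)

-- The continued fraction [b, 1/b, t], that is, one block of F put in front of a tail t.
pair : ℚ⁺ → ℚ⁺ → ℚ⁺
pair b t = b +⁺ (1/⁺ ((1/⁺ b) +⁺ (1/⁺ t)))

-- This is [b, 1/b, t] = b(2t + b)/(t + b), a fraction homogeneous of degree 1 in b and t.
pair-value : ∀ b t → value (pair b t) ℚ.* (value t ℚ.+ value b) ≡
  value b ℚ.* (value t ℚ.+ value t ℚ.+ value b)
pair-value b t = eliminate (value (pair b t)) (value s) (value t) (value b)
  (value (1/⁺ b)) (+1/⁺-* b s) (+1/⁺-* (1/⁺ b) t) (1/⁺-inverseˡ b)
  where
  s : ℚ⁺
  s = (1/⁺ b) +⁺ (1/⁺ t)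
  open ≡-Reasoning
  eliminate : ∀ v s t b c → v ℚ.* s ≡ b ℚ.* s ℚ.+ 1ℚ →
    s ℚ.* t ≡ c ℚ.* t ℚ.+ 1ℚ → c ℚ.* b ≡ 1ℚ →
    v ℚ.* (t ℚ.+ b) ≡ b ℚ.* (t ℚ.+ t ℚ.+ b)
  eliminate v s t b c vs st cb = begin
    -- With s = 1/b + 1/t and c = 1/b, the product stb is t + b. Multiplying vs = bs + 1 by tb
    -- therefore eliminates s.
    v ℚ.* (t ℚ.+ b)                          ≡⟨ cong (v ℚ.*_) stb ⟨
    v ℚ.* (s ℚ.* t ℚ.* b)                    ≡⟨ solve 4 (λ v s t b →
      v :* (s :* t :* b) := v :* s :* (t :* b)) refl v s t b ⟩
    v ℚ.* s ℚ.* (t ℚ.* b)                    ≡⟨ cong (ℚ._* (t ℚ.* b)) vs ⟩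
    (b ℚ.* s ℚ.+ 1ℚ) ℚ.* (t ℚ.* b)           ≡⟨ solve 3 (λ s t b →
      (b :* s :+ con 1ℚ) :* (t :* b) := b :* (s :* t :* b) :+ t :* b) refl s t b ⟩
    b ℚ.* (s ℚ.* t ℚ.* b) ℚ.+ t ℚ.* b        ≡⟨ cong (λ r → b ℚ.* r ℚ.+ t ℚ.* b) stb ⟩
    b ℚ.* (t ℚ.+ b) ℚ.+ t ℚ.* b              ≡⟨ solve 2 (λ t b →
      b :* (t :+ b) :+ t :* b := b :* (t :+ t :+ b)) refl t b ⟩
    b ℚ.* (t ℚ.+ t ℚ.+ b)                    ∎
    where
    stb : s ℚ.* t ℚ.* b ≡ t ℚ.+ b
    stb = begin
      s ℚ.* t ℚ.* b              ≡⟨ cong (ℚ._* b) st ⟩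
      (c ℚ.* t ℚ.+ 1ℚ) ℚ.* b     ≡⟨ solve 3 (λ c t b →
        (c :* t :+ con 1ℚ) :* b := c :* b :* t :+ b) refl c t b ⟩
      c ℚ.* b ℚ.* t ℚ.+ b        ≡⟨ cong (λ r → r ℚ.* t ℚ.+ b) cb ⟩
      1ℚ ℚ.* t ℚ.+ b             ≡⟨ cong (ℚ._+ b) (ℚ.*-identityˡ t) ⟩
      t ℚ.+ b                    ∎

-- Homogeneity of the formula in `pair-value`: both sides acquire a factor q², one q of which
-- belongs to the denominator.
pair-scale : ∀ q b t b′ t′ → value b′ ≡ q ℚ.* value b → value t′ ≡ q ℚ.* value t →
  .{{Positive q}} → value (pair b′ t′) ≡ q ℚ.* value (pair b t)
pair-scale q b t b′ t′ b′≡ t′≡ = *-cancelʳ-pos (value t′ ℚ.+ value b′)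
  {{ℚ.positive (ℚ.+-mono-< (0<value t′) (0<value b′))}} (begin
  value (pair b′ t′) ℚ.* (value t′ ℚ.+ value b′)   ≡⟨ pair-value b′ t′ ⟩
  value b′ ℚ.* (value t′ ℚ.+ value t′ ℚ.+ value b′)
    ≡⟨ cong₂ (λ β τ → β ℚ.* (τ ℚ.+ τ ℚ.+ β)) b′≡ t′≡ ⟩
  q ℚ.* value b ℚ.* (q ℚ.* value t ℚ.+ q ℚ.* value t ℚ.+ q ℚ.* value b)
    ≡⟨ solve 3 (λ q b t → q :* b :* (q :* t :+ q :* t :+ q :* b) :=
         q :* q :* (b :* (t :+ t :+ b))) refl q (value b) (value t) ⟩
  q ℚ.* q ℚ.* (value b ℚ.* (value t ℚ.+ value t ℚ.+ value b))
    ≡⟨ cong (q ℚ.* q ℚ.*_) (pair-value b t) ⟨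
  q ℚ.* q ℚ.* (value (pair b t) ℚ.* (value t ℚ.+ value b))
    ≡⟨ solve 4 (λ q v t b → q :* q :* (v :* (t :+ b)) :=
         q :* v :* (q :* t :+ q :* b)) refl q (value (pair b t)) (value t) (value b) ⟩
  q ℚ.* value (pair b t) ℚ.* (q ℚ.* value t ℚ.+ q ℚ.* value b)
    ≡⟨ cong₂ (λ β τ → q ℚ.* value (pair b t) ℚ.* (τ ℚ.+ β)) b′≡ t′≡ ⟨
  q ℚ.* value (pair b t) ℚ.* (value t′ ℚ.+ value b′)  ∎)
  where
  open ≡-Reasoning

-- The recurrence shared by F and F*.

module _ (x : ℕ) .{{_ : NonZero x}} where

  ι-pos : Positive (ι x)
  ι-pos = ℚ.normalize-pos x 1

  ^⁺-suc : ∀ i → value (x ^⁺ suc i) ≡ ι x ℚ.* value (x ^⁺ i)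
  ^⁺-suc i = ι-* x (x ℕ.^ i)

  pairs : List ℕ → List ℚ⁺
  pairs = concatMap (λ i → x ^⁺ i ∷ 1/⁺ (x ^⁺ i) ∷ [])

  -- Raising all exponents by one multiplies each block parameter by x, and `pair-scale` passes the
  -- factor outwards block by block. The endings `t` and `t′` stay arbitrary to cover both F and F*.
  scale : ∀ is t t′ → value ⟦ t′ ⟧ ≡ ι x ℚ.* value ⟦ t ⟧ →
    value ⟦ pairs (List.map suc is) ++⁺ t′ ⟧ ≡ ι x ℚ.* value ⟦ pairs is ++⁺ t ⟧
  scale []       t t′ eq = eq
  scale (i ∷ is) t t′ eq = pair-scale (ι x) (x ^⁺ i) ⟦ pairs is ++⁺ t ⟧
    (x ^⁺ suc i) ⟦ pairs (List.map suc is) ++⁺ t′ ⟧ (^⁺-suc i) (scale is t t′ eq) {{ι-pos}}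

  -- Behind the first block x, 1/x stands a copy of the shorter fraction f with all exponents raised
  -- by one, hence of value xf. Then `pair-value` with b = x and t = xf gives x(2f + 1)/(f + 1)
  -- after cancelling x.
  quotients-suc : ∀ k t t′ → value ⟦ t′ ⟧ ≡ ι x ℚ.* value ⟦ t ⟧ →
    let f = value ⟦ quotients x k ++⁺ t ⟧ in
    value ⟦ quotients x (suc k) ++⁺ t′ ⟧ ℚ.* (f ℚ.+ 1ℚ) ≡ ι x ℚ.* (f ℚ.+ f ℚ.+ 1ℚ)
  quotients-suc k t t′ eq = cancel (value (pair (x ^⁺ 1) r))
    (value ⟦ quotients x k ++⁺ t ⟧) (subst₂ (λ β τ → value (pair (x ^⁺ 1) r) ℚ.* (τ ℚ.+ β) ≡
      β ℚ.* (τ ℚ.+ τ ℚ.+ β)) (cong ι (ℕ.*-identityʳ x)) r-value (pair-value (x ^⁺ 1) r))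
    where
    r : ℚ⁺
    r = ⟦ pairs (applyUpTo (λ i → suc (suc i)) k) ++⁺ t′ ⟧
    r-value : value r ≡ ι x ℚ.* value ⟦ quotients x k ++⁺ t ⟧
    r-value = subst
      (λ is → value ⟦ pairs is ++⁺ t′ ⟧ ≡ ι x ℚ.* value ⟦ quotients x k ++⁺ t ⟧)
      (map-applyUpTo suc suc k) (scale (applyUpTo suc k) t t′ eq)
    cancel : ∀ v f → v ℚ.* (ι x ℚ.* f ℚ.+ ι x) ≡
      ι x ℚ.* (ι x ℚ.* f ℚ.+ ι x ℚ.* f ℚ.+ ι x) →
      v ℚ.* (f ℚ.+ 1ℚ) ≡ ι x ℚ.* (f ℚ.+ f ℚ.+ 1ℚ)
    cancel v f eq = *-cancelʳ-pos (ι x) {{ι-pos}} (trans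
      (solve 3 (λ v f q → v :* (f :+ con 1ℚ) :* q := v :* (q :* f :+ q)) refl v f (ι x))
      (trans eq (solve 2 (λ f q → q :* (q :* f :+ q :* f :+ q) :=
        q :* (f :+ f :+ con 1ℚ) :* q) refl f (ι x))))

  F*-suc : ∀ k → F* x (suc (suc k)) ℚ.* (F* x (suc k) ℚ.+ 1ℚ) ≡
    ι x ℚ.* (F* x (suc k) ℚ.+ F* x (suc k) ℚ.+ 1ℚ)
  F*-suc k = quotients-suc k (x ^⁺ suc k ∷ []) (x ^⁺ suc (suc k) ∷ []) (^⁺-suc (suc k))

  -- The closing block [b, 1/b] is worth 2b, so it too is multiplied by x when its exponent grows by
  -- one.
  F-suc : ∀ k → F x (suc (suc k)) ℚ.* (F x (suc k) ℚ.+ 1ℚ) ≡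
    ι x ℚ.* (F x (suc k) ℚ.+ F x (suc k) ℚ.+ 1ℚ)
  F-suc k = quotients-suc k (b ∷ 1/⁺ b ∷ []) (b′ ∷ 1/⁺ b′ ∷ []) (begin
    value (b′ +⁺ (1/⁺ (1/⁺ b′)))           ≡⟨ b+1/1/b b′ ⟩
    value b′ ℚ.+ value b′                  ≡⟨ cong (λ β → β ℚ.+ β) (^⁺-suc (suc k)) ⟩
    ι x ℚ.* value b ℚ.+ ι x ℚ.* value b    ≡⟨ ℚ.*-distribˡ-+ (ι x) (value b) (value b) ⟨
    ι x ℚ.* (value b ℚ.+ value b)          ≡⟨ cong (ι x ℚ.*_) (b+1/1/b b) ⟨
    ι x ℚ.* value (b +⁺ (1/⁺ (1/⁺ b)))     ∎)
    where
    open ≡-Reasoning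
    b b′ : ℚ⁺
    b  = x ^⁺ suc k
    b′ = x ^⁺ suc (suc k)

  F*-1 : F* x 1 ≡ ι x
  F*-1 = cong ι (ℕ.*-identityʳ x)

  F-1 : F x 1 ≡ ι x ℚ.+ ι x
  F-1 = trans (b+1/1/b (x ^⁺ 1)) (cong (λ β → β ℚ.+ β) F*-1)

-- Order and limits of rational sequences

0≤p*q : ∀ {p q} → 0ℚ ℚ.≤ p → 0ℚ ℚ.≤ q → 0ℚ ℚ.≤ p ℚ.* q
0≤p*q {p} {q} 0≤p 0≤q = ℚ.nonNegative⁻¹ (p ℚ.* q)
  {{ℚ.nonNeg*nonNeg⇒nonNeg p {{ℚ.nonNegative 0≤p}} q {{ℚ.nonNegative 0≤q}}}}

p≤p+q : ∀ p {q} → 0ℚ ℚ.≤ q → p ℚ.≤ p ℚ.+ q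
p≤p+q p {q} 0≤q = subst (ℚ._≤ p ℚ.+ q) (ℚ.+-identityʳ p) (ℚ.+-monoʳ-≤ p 0≤q)

-∣p∣≤p : ∀ p → ℚ.- ℚ.∣ p ∣ ℚ.≤ p
-∣p∣≤p p with ℚ.∣p∣≡p∨∣p∣≡-p p
... | inj₁ eq = ℚ.≤-trans (ℚ.neg-antimono-≤ (ℚ.0≤∣p∣ p)) (ℚ.∣p∣≡p⇒0≤p eq)
... | inj₂ eq = ℚ.≤-reflexive (trans (cong ℚ.-_ eq) (solve 1 (λ p → :- (:- p) := p) refl p))

∣p*q∣≡∣p∣*q : ∀ p {q} → 0ℚ ℚ.≤ q → ℚ.∣ p ℚ.* q ∣ ≡ ℚ.∣ p ∣ ℚ.* q
∣p*q∣≡∣p∣*q p {q} 0≤q = trans (ℚ.∣p*q∣≡∣p∣*∣q∣ p q) (cong (ℚ.∣ p ∣ ℚ.*_) (ℚ.0≤p⇒∣p∣≡p 0≤q))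

Vanishing : (ℕ → ℚ) → Set
Vanishing u = ∀ ε → 0ℚ ℚ.< ε → ∃[ N ] ∀ n → N ℕ.≤ n → ℚ.∣ u n ∣ ℚ.< ε

-- The linear bound (k + 1)|u k| ≤ |u 0| is enough in place of geometric decay; N is chosen at least
-- |u 0|/ε.
halving⇒vanishing : ∀ u → (∀ k → ℚ.∣ u (suc k) ∣ ℚ.+ ℚ.∣ u (suc k) ∣ ℚ.≤ ℚ.∣ u k ∣) →
  Vanishing u
halving⇒vanishing u halving ε 0<ε = N , λ k N≤k →
  ℚ.*-cancelˡ-<-nonNeg (ι (suc k)) {{ℚ.nonNegative (0≤ι (suc k))}} (begin-strict
    ι (suc k) ℚ.* ℚ.∣ u k ∣     ≤⟨ decay k ⟩
    ℚ.∣ u 0 ∣                   ≡⟨ ℚ.*-identityʳ ℚ.∣ u 0 ∣ ⟨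
    ℚ.∣ u 0 ∣ ℚ.* 1ℚ            ≡⟨ cong (ℚ.∣ u 0 ∣ ℚ.*_) (ℚ.*-inverseˡ ε) ⟨
    ℚ.∣ u 0 ∣ ℚ.* (1/ε ℚ.* ε)   ≡⟨ ℚ.*-assoc ℚ.∣ u 0 ∣ 1/ε ε ⟨
    ℚ.∣ u 0 ∣ ℚ.* 1/ε ℚ.* ε     ≤⟨ ℚ.*-monoʳ-≤-nonNeg ε {{ℚ.pos⇒nonNeg ε}} C≤N ⟩
    ι N ℚ.* ε                   ≤⟨ ℚ.*-monoʳ-≤-nonNeg ε {{ℚ.pos⇒nonNeg ε}} (ι-mono-≤ N≤k) ⟩
    ι k ℚ.* ε                   <⟨ ℚ.*-monoˡ-<-pos ε (ι<ι-suc k) ⟩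
    ι (suc k) ℚ.* ε             ∎)
  where
  open ℚ.≤-Reasoning
  instance
    ε-pos : Positive ε
    ε-pos = ℚ.positive 0<ε
    ε≢0 : ℚ.NonZero ε
    ε≢0 = ℚ.pos⇒nonZero ε
  1/ε : ℚ
  1/ε = ℚ.1/ ε
  N : ℕ
  N = proj₁ (archimedean (ℚ.∣ u 0 ∣ ℚ.* 1/ε))
  C≤N : ℚ.∣ u 0 ∣ ℚ.* 1/ε ℚ.≤ ι N
  C≤N = proj₂ (archimedean (ℚ.∣ u 0 ∣ ℚ.* 1/ε))
  0≤ι : ∀ n → 0ℚ ℚ.≤ ι n
  0≤ι n = ι-mono-≤ (ℕ.z≤n {n})
  ι<ι-suc : ∀ n → ι n ℚ.< ι (suc n)
  ι<ι-suc n = subst₂ ℚ._<_ (ℚ.+-identityˡ (ι n)) (sym (ι-+ 1 n))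
    (ℚ.+-monoˡ-< (ι n) (ℚ.positive⁻¹ 1ℚ))
  decay : ∀ k → ι (suc k) ℚ.* ℚ.∣ u k ∣ ℚ.≤ ℚ.∣ u 0 ∣
  decay zero    = ℚ.≤-reflexive (ℚ.*-identityˡ ℚ.∣ u 0 ∣)
  decay (suc k) = begin
    -- The induction rests on k + 2 ≤ 2(k + 1).
    ι (suc (suc k)) ℚ.* v   ≤⟨ ℚ.*-monoʳ-≤-nonNeg v {{ℚ.∣-∣-nonNeg (u (suc k))}}
                                 (ι-mono-≤ (ℕ.s≤s (ℕ.m≤n+m (suc k) k))) ⟩
    ι (suc k ℕ.+ suc k) ℚ.* v           ≡⟨ cong (ℚ._* v) (ι-+ (suc k) (suc k)) ⟩
    (ι (suc k) ℚ.+ ι (suc k)) ℚ.* v     ≡⟨ solve 2 (λ m v →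
      (m :+ m) :* v := m :* (v :+ v)) refl (ι (suc k)) v ⟩
    ι (suc k) ℚ.* (v ℚ.+ v)             ≤⟨ ℚ.*-monoˡ-≤-nonNeg (ι (suc k))
                                             {{ℚ.nonNegative (0≤ι (suc k))}} (halving k) ⟩
    ι (suc k) ℚ.* ℚ.∣ u k ∣             ≤⟨ decay k ⟩
    ℚ.∣ u 0 ∣                           ∎
    where
    v : ℚ
    v = ℚ.∣ u (suc k) ∣

-- The quadratic and its approximate roots

Pℚ : ℚ → ℚ → ℚ
Pℚ q z = z ℚ.* z ℚ.- (ι 2 ℚ.* q ℚ.- 1ℚ) ℚ.* z ℚ.- q

module _ (q : ℚ) (1≤q : 1ℚ ℚ.≤ q) where
  private
    0<q : 0ℚ ℚ.< q
    0<q = ℚ.<-≤-trans (ℚ.positive⁻¹ 1ℚ) 1≤q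
    0≤q : 0ℚ ℚ.≤ q
    0≤q = ℚ.<⇒≤ 0<q
    instance
      q-pos : Positive q
      q-pos = ℚ.positive 0<q
      q-nonNeg : ℚ.NonNegative q
      q-nonNeg = ℚ.nonNegative 0≤q

  module _ (a b : ℚ) (step : b ℚ.* (a ℚ.+ 1ℚ) ≡ q ℚ.* (a ℚ.+ a ℚ.+ 1ℚ)) (q≤a : q ℚ.≤ a) where
    private
      0≤a : 0ℚ ℚ.≤ a
      0≤a = ℚ.≤-trans 0≤q q≤a
      instance
        a+1-pos : Positive (a ℚ.+ 1ℚ)
        a+1-pos = ℚ.positive (ℚ.+-mono-≤-< 0≤a (ℚ.positive⁻¹ 1ℚ))

    -- Here b = g(a). The interval from q to 2q is preserved because q(2a + 1) exceeds q(a + 1) by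
    -- qa and falls short of 2q(a + 1) by q.
    step-lower : q ℚ.≤ b
    step-lower = ℚ.*-cancelʳ-≤-pos (a ℚ.+ 1ℚ) (begin
      q ℚ.* (a ℚ.+ 1ℚ)               ≤⟨ p≤p+q (q ℚ.* (a ℚ.+ 1ℚ)) (0≤p*q 0≤q 0≤a) ⟩
      q ℚ.* (a ℚ.+ 1ℚ) ℚ.+ q ℚ.* a   ≡⟨ solve 2 (λ q a →
        q :* (a :+ con 1ℚ) :+ q :* a := q :* (a :+ a :+ con 1ℚ)) refl q a ⟩
      q ℚ.* (a ℚ.+ a ℚ.+ 1ℚ)         ≡⟨ step ⟨
      b ℚ.* (a ℚ.+ 1ℚ)               ∎)
      where open ℚ.≤-Reasoning

    step-upper : b ℚ.≤ q ℚ.+ q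
    step-upper = ℚ.*-cancelʳ-≤-pos (a ℚ.+ 1ℚ) (begin
      b ℚ.* (a ℚ.+ 1ℚ)               ≡⟨ step ⟩
      q ℚ.* (a ℚ.+ a ℚ.+ 1ℚ)         ≤⟨ p≤p+q (q ℚ.* (a ℚ.+ a ℚ.+ 1ℚ)) 0≤q ⟩
      q ℚ.* (a ℚ.+ a ℚ.+ 1ℚ) ℚ.+ q   ≡⟨ solve 2 (λ q a →
        q :* (a :+ a :+ con 1ℚ) :+ q := (q :+ q) :* (a :+ con 1ℚ)) refl q a ⟩
      (q ℚ.+ q) ℚ.* (a ℚ.+ 1ℚ)       ∎)
      where open ℚ.≤-Reasoning

    -- After multiplication by (a + 1)², b occurs only in the product b(a + 1), which `step`
    -- replaces; a polynomial identity in q and a remains.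
    Pℚ-step : Pℚ q b ℚ.* ((a ℚ.+ 1ℚ) ℚ.* (a ℚ.+ 1ℚ)) ≡ Pℚ q a ℚ.* q
    Pℚ-step = begin
      Pℚ q b ℚ.* ((a ℚ.+ 1ℚ) ℚ.* (a ℚ.+ 1ℚ))   ≡⟨ solve 3 (λ q a b →
        (b :* b :- (con (ι 2) :* q :- con 1ℚ) :* b :- q) :* ((a :+ con 1ℚ) :* (a :+ con 1ℚ)) :=
        b :* (a :+ con 1ℚ) :* (b :* (a :+ con 1ℚ)) :-
        (con (ι 2) :* q :- con 1ℚ) :* (b :* (a :+ con 1ℚ)) :* (a :+ con 1ℚ) :-
        q :* (a :+ con 1ℚ) :* (a :+ con 1ℚ)) refl q a b ⟩
      homogenized (b ℚ.* (a ℚ.+ 1ℚ))                 ≡⟨ cong homogenized step ⟩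
      homogenized (q ℚ.* (a ℚ.+ a ℚ.+ 1ℚ))           ≡⟨ solve 2 (λ q a →
        q :* (a :+ a :+ con 1ℚ) :* (q :* (a :+ a :+ con 1ℚ)) :-
        (con (ι 2) :* q :- con 1ℚ) :* (q :* (a :+ a :+ con 1ℚ)) :* (a :+ con 1ℚ) :-
        q :* (a :+ con 1ℚ) :* (a :+ con 1ℚ) :=
        (a :* a :- (con (ι 2) :* q :- con 1ℚ) :* a :- q) :* q) refl q a ⟩
      Pℚ q a ℚ.* q                             ∎
      where
      open ≡-Reasoning
      homogenized : ℚ → ℚ
      homogenized w = w ℚ.* w ℚ.- (ι 2 ℚ.* q ℚ.- 1ℚ) ℚ.* w ℚ.* (a ℚ.+ 1ℚ) ℚ.-
        q ℚ.* (a ℚ.+ 1ℚ) ℚ.* (a ℚ.+ 1ℚ)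

    -- The factor q/(a + 1)² is at most 1/2, since (a + 1)² = 2a + (a² + 1) ≥ 2a ≥ 2q.
    Pℚ-halving : ℚ.∣ Pℚ q b ∣ ℚ.+ ℚ.∣ Pℚ q b ∣ ℚ.≤ ℚ.∣ Pℚ q a ∣
    Pℚ-halving = ℚ.*-cancelʳ-≤-pos q (begin
      (u ℚ.+ u) ℚ.* q                               ≤⟨ ℚ.*-monoˡ-≤-nonNeg (u ℚ.+ u)
        {{ℚ.nonNegative (ℚ.+-mono-≤ 0≤u 0≤u)}} q≤a ⟩
      (u ℚ.+ u) ℚ.* a                               ≤⟨ p≤p+q ((u ℚ.+ u) ℚ.* a)
        (0≤p*q 0≤u (ℚ.+-mono-≤ (0≤p*q 0≤a 0≤a) (ℚ.nonNegative⁻¹ 1ℚ))) ⟩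
      (u ℚ.+ u) ℚ.* a ℚ.+ u ℚ.* (a ℚ.* a ℚ.+ 1ℚ)    ≡⟨ solve 2 (λ u a →
        (u :+ u) :* a :+ u :* (a :* a :+ con 1ℚ) :=
        u :* ((a :+ con 1ℚ) :* (a :+ con 1ℚ))) refl u a ⟩
      u ℚ.* ((a ℚ.+ 1ℚ) ℚ.* (a ℚ.+ 1ℚ))             ≡⟨ ∣p*q∣≡∣p∣*q (Pℚ q b)
        (0≤p*q 0≤a+1 0≤a+1) ⟨
      ℚ.∣ Pℚ q b ℚ.* ((a ℚ.+ 1ℚ) ℚ.* (a ℚ.+ 1ℚ)) ∣  ≡⟨ cong ℚ.∣_∣ Pℚ-step ⟩
      ℚ.∣ Pℚ q a ℚ.* q ∣                            ≡⟨ ∣p*q∣≡∣p∣*q (Pℚ q a) 0≤q ⟩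
      ℚ.∣ Pℚ q a ∣ ℚ.* q                            ∎)
      where
      open ℚ.≤-Reasoning
      u : ℚ
      u = ℚ.∣ Pℚ q b ∣
      0≤u : 0ℚ ℚ.≤ u
      0≤u = ℚ.0≤∣p∣ (Pℚ q b)
      0≤a+1 : 0ℚ ℚ.≤ a ℚ.+ 1ℚ
      0≤a+1 = ℚ.<⇒≤ (ℚ.positive⁻¹ (a ℚ.+ 1ℚ))

  -- The factor c = P(a) + q + ab stays away from 0, and (a − b) c = a (P(a) − P(b)).
  ∣-∣≤4*∣P-P∣ : ∀ a b → 0ℚ ℚ.≤ a → a ℚ.≤ q ℚ.+ q → 0ℚ ℚ.≤ b → ℚ.∣ Pℚ q a ∣ ℚ.≤ ½ →
    ℚ.∣ a ℚ.- b ∣ ℚ.≤ ι 4 ℚ.* ℚ.∣ Pℚ q a ℚ.- Pℚ q b ∣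
  ∣-∣≤4*∣P-P∣ a b 0≤a a≤2q 0≤b small = ℚ.*-cancelʳ-≤-pos q (begin
    -- The constant 4 comes from c ≥ q - 1/2 ≥ q/2, where q ≥ 1 enters, together with a ≤ 2q.
    d ℚ.* q                        ≤⟨ ℚ.*-monoˡ-≤-nonNeg d {{ℚ.∣-∣-nonNeg (a ℚ.- b)}} q≤2c ⟩
    d ℚ.* (c ℚ.+ c)                ≡⟨ ℚ.*-distribˡ-+ d c c ⟩
    d ℚ.* c ℚ.+ d ℚ.* c            ≡⟨ cong (λ r → r ℚ.+ r) (trans
      (sym (∣p*q∣≡∣p∣*q (a ℚ.- b) 0≤c)) (trans (cong ℚ.∣_∣ factor) (∣p*q∣≡∣p∣*q (Pℚ q a ℚ.- Pℚ q b) 0≤a))) ⟩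
    e ℚ.* a ℚ.+ e ℚ.* a            ≡⟨ ℚ.*-distribˡ-+ e a a ⟨
    e ℚ.* (a ℚ.+ a)                ≤⟨ ℚ.*-monoˡ-≤-nonNeg e
      {{ℚ.∣-∣-nonNeg (Pℚ q a ℚ.- Pℚ q b)}} (ℚ.+-mono-≤ a≤2q a≤2q) ⟩
    e ℚ.* (q ℚ.+ q ℚ.+ (q ℚ.+ q))  ≡⟨ solve 2 (λ e q →
      e :* (q :+ q :+ (q :+ q)) := con (ι 4) :* e :* q) refl e q ⟩
    ι 4 ℚ.* e ℚ.* q                ∎)
    where
    open ℚ.≤-Reasoning
    c d e : ℚ
    c = Pℚ q a ℚ.+ q ℚ.+ a ℚ.* b
    d = ℚ.∣ a ℚ.- b ∣
    e = ℚ.∣ Pℚ q a ℚ.- Pℚ q b ∣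
    factor : (a ℚ.- b) ℚ.* c ≡ (Pℚ q a ℚ.- Pℚ q b) ℚ.* a
    factor = solve 3 (λ q a b →
      let P z = z :* z :- (con (ι 2) :* q :- con 1ℚ) :* z :- q in
      (a :- b) :* (P a :+ q :+ a :* b) := (P a :- P b) :* a) refl q a b
    q-½≤c : q ℚ.- ½ ℚ.≤ c
    q-½≤c = begin
      q ℚ.- ½                       ≡⟨ ℚ.+-comm q (ℚ.- ½) ⟩
      ℚ.- ½ ℚ.+ q                   ≤⟨ ℚ.+-monoˡ-≤ q (ℚ.≤-trans (ℚ.neg-antimono-≤ small) (-∣p∣≤p (Pℚ q a))) ⟩
      Pℚ q a ℚ.+ q                  ≤⟨ p≤p+q (Pℚ q a ℚ.+ q) (0≤p*q 0≤a 0≤b) ⟩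
      c                             ∎
    0≤c : 0ℚ ℚ.≤ c
    0≤c = ℚ.≤-trans (ℚ.≤-trans (ℚ.nonNegative⁻¹ ½) (ℚ.+-monoˡ-≤ (ℚ.- ½) 1≤q)) q-½≤c
    q≤2c : q ℚ.≤ c ℚ.+ c
    q≤2c = begin
      q                               ≤⟨ p≤p+q q (ℚ.+-monoˡ-≤ (ℚ.- 1ℚ) 1≤q) ⟩
      q ℚ.+ (q ℚ.- 1ℚ)                ≡⟨ solve 1 (λ q →
        q :+ (q :- con 1ℚ) := (q :- con ½) :+ (q :- con ½)) refl q ⟩
      (q ℚ.- ½) ℚ.+ (q ℚ.- ½)         ≤⟨ ℚ.+-mono-≤ q-½≤c q-½≤c ⟩
      c ℚ.+ c                         ∎

  record Approximation (a : ℕ → ℚ) : Set where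
    field
      lower     : ∀ k → q ℚ.≤ a k
      upper     : ∀ k → a k ℚ.≤ q ℚ.+ q
      vanishing : Vanishing (λ k → Pℚ q (a k))

    nonNeg : ∀ k → 0ℚ ℚ.≤ a k
    nonNeg k = ℚ.≤-trans 0≤q (lower k)

  iterates-approximate : ∀ a → q ℚ.≤ a 0 → a 0 ℚ.≤ q ℚ.+ q →
    (∀ k → a (suc k) ℚ.* (a k ℚ.+ 1ℚ) ≡ q ℚ.* (a k ℚ.+ a k ℚ.+ 1ℚ)) → Approximation a
  iterates-approximate a q≤a₀ a₀≤2q steps = record
    { lower     = lower
    ; upper     = upper
    ; vanishing = halving⇒vanishing (λ k → Pℚ q (a k))
        λ k → Pℚ-halving (a k) (a (suc k)) (steps k) (lower k)
    }
    where
    lower : ∀ k → q ℚ.≤ a k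
    lower zero    = q≤a₀
    lower (suc k) = step-lower (a k) (a (suc k)) (steps k) (lower k)
    upper : ∀ k → a k ℚ.≤ q ℚ.+ q
    upper zero    = a₀≤2q
    upper (suc k) = step-upper (a k) (a (suc k)) (steps k) (lower k)

  -- Taking for `b` the orbit itself yields the Cauchy property, and taking a sequence that
  -- represents a positive root yields convergence and uniqueness. The two indices are independent
  -- for the sake of the former.
  approximation-close : ∀ {a} (b : ℕ → ℚ) → Approximation a →
    ∃[ N ] (∀ n → N ℕ.≤ n → 0ℚ ℚ.≤ b n) → Vanishing (λ n → Pℚ q (b n)) →
    ∀ ε → 0ℚ ℚ.< ε → ∃[ N ] ∀ m n → N ℕ.≤ m → N ℕ.≤ n → ℚ.∣ a m ℚ.- b n ∣ ℚ.< ε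
  approximation-close {a} b approx (N₁ , 0≤b) Pb→0 ε 0<ε =
    -- 8 is the constant 4 of `∣-∣≤4*∣P-P∣` times the two terms |P(a)| and |P(b)|, each below δ.
    let δ , 0<δ , 8δ≡ε = CauchyProperties.split (ι 8) (ℚ.positive⁻¹ (ι 8)) ε 0<ε
        N₂ , Pa<½ = vanishing ½ (ℚ.positive⁻¹ ½)
        N₃ , Pa<δ = vanishing δ 0<δ
        N₄ , Pb<δ = Pb→0 δ 0<δ
    in (N₁ ℕ.⊔ N₂) ℕ.⊔ (N₃ ℕ.⊔ N₄) , λ m n N≤m N≤n →
      let m₁₂ = ℕ.m⊔n≤o⇒m≤o (N₁ ℕ.⊔ N₂) (N₃ ℕ.⊔ N₄) N≤m
          n₁₂ = ℕ.m⊔n≤o⇒m≤o (N₁ ℕ.⊔ N₂) (N₃ ℕ.⊔ N₄) N≤n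
          m₃₄ = ℕ.m⊔n≤o⇒n≤o (N₁ ℕ.⊔ N₂) (N₃ ℕ.⊔ N₄) N≤m
          n₃₄ = ℕ.m⊔n≤o⇒n≤o (N₁ ℕ.⊔ N₂) (N₃ ℕ.⊔ N₄) N≤n
          Pa = Pℚ q (a m)
          Pb = Pℚ q (b n)
      in begin-strict
        ℚ.∣ a m ℚ.- b n ∣
          ≤⟨ ∣-∣≤4*∣P-P∣ (a m) (b n) (nonNeg m) (upper m)
               (0≤b n (ℕ.m⊔n≤o⇒m≤o N₁ N₂ n₁₂))
               (ℚ.<⇒≤ (Pa<½ m (ℕ.m⊔n≤o⇒n≤o N₁ N₂ m₁₂))) ⟩
        ι 4 ℚ.* ℚ.∣ Pa ℚ.- Pb ∣
          ≤⟨ ℚ.*-monoˡ-≤-nonNeg (ι 4) (ℚ.∣p-q∣≤∣p∣+∣q∣ Pa Pb) ⟩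
        ι 4 ℚ.* (ℚ.∣ Pa ∣ ℚ.+ ℚ.∣ Pb ∣)
          <⟨ ℚ.*-monoʳ-<-pos (ι 4) (ℚ.+-mono-<
               (Pa<δ m (ℕ.m⊔n≤o⇒m≤o N₃ N₄ m₃₄)) (Pb<δ n (ℕ.m⊔n≤o⇒n≤o N₃ N₄ n₃₄))) ⟩
        ι 4 ℚ.* (δ ℚ.+ δ)
          ≡⟨ solve 1 (λ δ → con (ι 4) :* (δ :+ δ) := con (ι 8) :* δ) refl δ ⟩
        ι 8 ℚ.* δ
          ≡⟨ 8δ≡ε ⟩
        ε ∎
    where
    open Approximation approx
    open ℚ.≤-Reasoning

-- Convergence to the root

module _ (x : ℕ) .{{_ : NonZero x}} where
  private
    q : ℚ
    q = ι x
    1≤q : 1ℚ ℚ.≤ q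
    1≤q = ι-mono-≤ (ℕ.>-nonZero⁻¹ x)
    q≤2q : q ℚ.≤ q ℚ.+ q
    q≤2q = p≤p+q q (ι-mono-≤ (ℕ.z≤n {x}))

  F-approximation : Approximation q 1≤q (λ k → F x (suc k))
  F-approximation = iterates-approximate q 1≤q (λ k → F x (suc k))
    (subst (q ℚ.≤_) (sym (F-1 x)) q≤2q) (ℚ.≤-reflexive (F-1 x)) (F-suc x)

  F*-approximation : Approximation q 1≤q (λ k → F* x (suc k))
  F*-approximation = iterates-approximate q 1≤q (λ k → F* x (suc k))
    (ℚ.≤-reflexive (sym (F*-1 x))) (subst (ℚ._≤ q ℚ.+ q) (sym (F*-1 x)) q≤2q) (F*-suc x)

  positiveRoot-nonNeg : ∀ z → IsPositiveRoot x z → ∃[ N ] ∀ n → N ℕ.≤ n → 0ℚ ℚ.≤ seq z n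
  positiveRoot-nonNeg z ((ε , 0<ε , N , ε<z) , _) = N , λ n N≤n →
    ℚ.<⇒≤ (ℚ.<-trans (ℚ.+-mono-≤-< ℚ.≤-refl 0<ε) (ε<z n N≤n))

  positiveRoot-vanishing : ∀ z → IsPositiveRoot x z → Vanishing (λ n → Pℚ q (seq z n))
  positiveRoot-vanishing z (_ , Pz≃0) ε 0<ε =
    let N , close = Pz≃0 ε 0<ε
    -- Real arithmetic is termwise, so `P (fromℕ x) z` has the terms `Pℚ q (seq z n)` by
    -- computation; only the subtracted 0 has to be removed.
    in N , λ n N≤n → subst (λ r → ℚ.∣ r ∣ ℚ.< ε) (ℚ.+-identityʳ (Pℚ q (seq z n))) (close n N≤n)

  positiveRoot-close : ∀ {a} → Approximation q 1≤q a → ∀ z → IsPositiveRoot x z →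
    ∀ ε → 0ℚ ℚ.< ε → ∃[ N ] ∀ m n → N ℕ.≤ m → N ℕ.≤ n → ℚ.∣ a m ℚ.- seq z n ∣ ℚ.< ε
  positiveRoot-close approx z root = approximation-close q 1≤q (seq z) approx
    (positiveRoot-nonNeg z root) (positiveRoot-vanishing z root)

  -- The root is represented by the orbit of F itself, shifted by one because F starts at index 1.
  limit : ℝ
  limit = mkℝ (λ k → F x (suc k)) (approximation-close q 1≤q
    (λ k → F x (suc k)) F-approximation
    (0 , λ n _ → Approximation.nonNeg F-approximation n)
    (Approximation.vanishing F-approximation))

  limit-positiveRoot : IsPositiveRoot x limit
  limit-positiveRoot =
    -- Any margin below 1 would do, as every term is at least q ≥ 1.
    (½ , ℚ.positive⁻¹ ½ , 0 , λ n _ →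
      ℚ.<-≤-trans ½<1 (ℚ.≤-trans 1≤q (Approximation.lower F-approximation n))) ,
    λ ε 0<ε → let N , close = Approximation.vanishing F-approximation ε 0<ε
      in N , λ n N≤n → subst (λ r → ℚ.∣ r ∣ ℚ.< ε)
           (sym (ℚ.+-identityʳ (Pℚ q (F x (suc n))))) (close n N≤n)
    where
    ½<1 : ½ ℚ.< 1ℚ
    ½<1 = ℚ.+-monoʳ-< ½ (ℚ.positive⁻¹ ½)

  approximation-⟶ : ∀ (s : (k : ℕ) .{{_ : NonZero k}} → ℚ) →
    Approximation q 1≤q (λ k → s (suc k)) → ∀ z → IsPositiveRoot x z →
    (λ k → fromℚ (s k)) ⟶ z
  approximation-⟶ s approx z root ε (e , 0<e , M , e<ε) =
    -- The rational e lies below the real ε. One half of e bounds the distance, the other is the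
    -- positive gap that `_<_` on reals demands.
    let N , close = positiveRoot-close approx z root (½ ℚ.* e) (0<½* e 0<e)
    -- The approximation at index k is `s (suc k)`, which shifts the threshold by one.
    in suc N , λ where
      (suc k) 1+N≤1+k → ½ ℚ.* e , 0<½* e 0<e , M ℕ.⊔ N , λ n M⊔N≤n → begin-strict
        ℚ.∣ s (suc k) ℚ.- seq z n ∣ ℚ.+ ½ ℚ.* e
          <⟨ ℚ.+-monoˡ-< (½ ℚ.* e)
               (close k n (ℕ.s≤s⁻¹ 1+N≤1+k) (ℕ.m⊔n≤o⇒n≤o M N M⊔N≤n)) ⟩
        ½ ℚ.* e ℚ.+ ½ ℚ.* e  ≡⟨ ½*+½* e ⟩
        e                    ≡⟨ ℚ.+-identityˡ e ⟨
        0ℚ ℚ.+ e             <⟨ e<ε n (ℕ.m⊔n≤o⇒m≤o M N M⊔N≤n) ⟩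
        seq ε n              ∎
    where
    open CauchyProperties using (0<½*; ½*+½*)
    open ℚ.≤-Reasoning

theorem15 : ∀ (x : ℕ) .{{_ : NonZero x}} →
    ∃! _≃_ (IsPositiveRoot x) ×
    (∀ z → IsPositiveRoot x z →
    ((λ k → fromℚ (F x k)) ⟶ z) × ((λ k → fromℚ (F* x k)) ⟶ z))
theorem15 x =
  -- For uniqueness, closeness of the orbit of F to `y` is read along equal indices, since this
  -- orbit represents `limit x`.
  (limit x , limit-positiveRoot x , λ {y} root ε 0<ε →
    let N , close = positiveRoot-close x (F-approximation x) y root ε 0<ε
    in N , λ n N≤n → close n n N≤n N≤n) ,
  λ z root →
    approximation-⟶ x (F x) (F-approximation x) z root ,
    approximation-⟶ x (F* x) (F*-approximation x) z root
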